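{- If $f\in\mathbb{N}^{\mathbb{N}}$ is a $\Pi^0_1$-singleton, then $f$ strongly relativizes $\Delta^0_1$ at $\mathbb{N}^{\mathbb{N}}$.
   Context: For a finite sequence $\sigma\in\mathbb{N}^{<\mathbb{N}}$, $[\sigma]=\{h\in\mathbb{N}^{\mathbb{N}}:\sigma\sqsubset h\}$. A subset of $\mathbb{N}^{\mathbb{N}}$ (resp. of $\mathbb{N}^{\mathbb{N}}\times\mathbb{N}^{\mathbb{N}}$) is $\Sigma^0_1$ if it is the union of a c.e. family of basic open sets $[\sigma]$ (resp. $[\sigma]\times[\tau]$), $\Pi^0_1$ if its complement is $\Sigma^0_1$, and $\Delta^0_1$ if it is both. $f$ is a $\Pi^0_1$-singleton if $\{f\}$ is a $\Pi^0_1$ subset of $\mathbb{N}^{\mathbb{N}}$. For $Q\subseteq\mathbb{N}^{\mathbb{N}}\times\mathbb{N}^{\mathbb{N}}$, $Q_f=\{g:Q(f,g)\}$. A set $P\subseteq\mathbb{N}^{\mathbb{N}}$ is $\Delta^0_1(f)$ if both $P$ and its complement are $f$-sections of $\Sigma^0_1$ subsets of $\mathbb{N}^{\mathbb{N}}\times\mathbb{N}^{\mathbb{N}}$. $f$ strongly relativizes $\Delta^0_1$ at $\mathbb{N}^{\mathbb{N}}$ if every $\Delta^0_1(f)$ set $P\subseteq\mathbb{N}^{\mathbb{N}}$ equals $Q_f$ for some $\Delta^0_1$ set $Q\subseteq\mathbb{N}^{\mathbb{N}}\times\mathbb{N}^{\mathbb{N}}$. -}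

module Defs where

open import Data.Fin.Base using (Fin; toℕ)
open import Data.List.Base using (List; []; _∷_; length; lookup)
open import Data.Nat.Base using (ℕ; zero; suc; _+_; _<_)
open import Data.Product.Base using (Σ-syntax; ∃-syntax; _×_; _,_)
open import Data.Sum.Base using (_⊎_)
open import Data.Vec.Base as Vec using (Vec; []; _∷_)
open import Data.Vec.Relation.Binary.Pointwise.Inductive using (Pointwise)
open import Level using (0ℓ)
open import Relation.Binary.PropositionalEquality using (_≡_; _≗_)
open import Relation.Unary using (Pred; _∈_; _≐_; ∁; Empty)

data Rec : ℕ → Set where
  zeroᴿ : ∀ {n} → Rec n
  sucᴿ  : Rec 1
  projᴿ : ∀ {n} → Fin n → Rec n
  compᴿ : ∀ {m n} → Rec m → Vec (Rec n) m → Rec n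
  precᴿ : ∀ {n} → Rec n → Rec (suc (suc n)) → Rec (suc n)
  muᴿ   : ∀ {n} → Rec (suc n) → Rec n

infix 4 _[_]↓_

-- p [ xs ]↓ y : the computation of p on arguments xs halts with value y.
data _[_]↓_ : ∀ {n} → Rec n → Vec ℕ n → ℕ → Set where
  zero↓  : ∀ {n} {xs : Vec ℕ n} → zeroᴿ [ xs ]↓ 0
  suc↓   : ∀ {x} → sucᴿ [ x ∷ [] ]↓ suc x
  proj↓  : ∀ {n} {xs : Vec ℕ n} (i : Fin n) → projᴿ i [ xs ]↓ Vec.lookup xs i
  comp↓  : ∀ {m n} {p : Rec m} {qs : Vec (Rec n) m} {xs ys z} →
           Pointwise (λ q y → q [ xs ]↓ y) qs ys → p [ ys ]↓ z →
           compᴿ p qs [ xs ]↓ z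
  prec↓₀ : ∀ {n} {p : Rec n} {q xs y} →
           p [ xs ]↓ y → precᴿ p q [ 0 ∷ xs ]↓ y
  prec↓₁ : ∀ {n} {p : Rec n} {q k xs y z} →
           precᴿ p q [ k ∷ xs ]↓ y → q [ k ∷ y ∷ xs ]↓ z →
           precᴿ p q [ suc k ∷ xs ]↓ z
  mu↓    : ∀ {n} {p : Rec (suc n)} {xs y} →
           (∀ i → i < y → ∃[ k ] p [ i ∷ xs ]↓ suc k) → p [ y ∷ xs ]↓ 0 →
           muᴿ p [ xs ]↓ y

Computable : (ℕ → ℕ) → Set
Computable f = ∃[ p ] ∀ x → p [ x ∷ [] ]↓ f x

triangle : ℕ → ℕ
triangle zero    = 0
triangle (suc n) = suc n + triangle n

-- Cantor's pairing bijection
pair : ℕ → ℕ → ℕ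
pair x y = triangle (x + y) + y

encode : List ℕ → ℕ
encode []      = 0
encode (x ∷ σ) = suc (pair x (encode σ))

encode₂ : List ℕ × List ℕ → ℕ
encode₂ (σ , τ) = pair (encode σ) (encode τ)

-- Empty, or the range of a total enumeration that is computable through the
-- numbering `code`.
CE : {A : Set} → (A → ℕ) → Pred A 0ℓ → Set
CE {A} code S =
  Empty S ⊎
  Σ[ e ∈ (ℕ → A) ] Computable (λ n → code (e n)) × S ≐ (λ a → ∃[ n ] e n ≡ a)

Baire : Set
Baire = ℕ → ℕ

infix 4 _⊏_

_⊏_ : List ℕ → Baire → Set
σ ⊏ h = ∀ (i : Fin (length σ)) → lookup σ i ≡ h (toℕ i)

[_] : List ℕ → Pred Baire 0ℓ
[ σ ] h = σ ⊏ h

[_]×[_] : List ℕ → List ℕ → Pred (Baire × Baire) 0ℓ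
[ σ ]×[ τ ] (f , g) = f ∈ [ σ ] × g ∈ [ τ ]

-- Classical notions: ∁ is negation, so complements behave as usual only under
-- excluded middle, which results about these classes take as a hypothesis.
module Effective {A X : Set} (code : A → ℕ) (basic : A → Pred X 0ℓ) where

  Σ⁰₁ : Pred X 0ℓ → Set₁
  Σ⁰₁ P = ∃[ W ] CE code W × P ≐ (λ x → ∃[ a ] a ∈ W × x ∈ basic a)

  Π⁰₁ : Pred X 0ℓ → Set₁
  Π⁰₁ P = Σ⁰₁ (∁ P)

  Δ⁰₁ : Pred X 0ℓ → Set₁
  Δ⁰₁ P = Σ⁰₁ P × Π⁰₁ P

module N  = Effective encode [_]
module N² = Effective encode₂ (λ (σ , τ) → [ σ ]×[ τ ])

-- Elements of Baire space are identified when they agree pointwise: without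
-- function extensionality, _≡_ on ℕ → ℕ is too fine.
singleton : Baire → Pred Baire 0ℓ
singleton f h = h ≗ f

Π⁰₁-Singleton : Baire → Set₁
Π⁰₁-Singleton f = N.Π⁰₁ (singleton f)

section : Pred (Baire × Baire) 0ℓ → Baire → Pred Baire 0ℓ
section Q f g = Q (f , g)

Δ⁰₁-in : Baire → Pred Baire 0ℓ → Set₁
Δ⁰₁-in f P =
  (∃[ Q ] N².Σ⁰₁ Q × P ≐ section Q f) × (∃[ Q ] N².Σ⁰₁ Q × ∁ P ≐ section Q f)

StronglyRelativizesΔ⁰₁ : Baire → Set₁
StronglyRelativizesΔ⁰₁ f =
  ∀ (P : Pred Baire 0ℓ) → Δ⁰₁-in f P → ∃[ Q ] N².Δ⁰₁ Q × P ≐ section Q f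

{-# OPTIONS --safe #-}

-- Let P = A_f and ∁P = B_f with A and B open, and let U be the effectively open
-- complement of {f}.  The open sets A and B ∪ (U × ℕ^ℕ) cover the whole space:
-- points over f lie in A ∪ B, all others in U × ℕ^ℕ.  Enumerate both sets
-- simultaneously and let Q consist of the points that enter A first.  Which set
-- a point enters first is determined by finitely much of it, so Q is Δ⁰₁; and
-- since U × ℕ^ℕ has no points over f, Q_f = P.
module Submission where

open import Axiom.ExcludedMiddle using (ExcludedMiddle)
open import Data.Empty using (⊥; ⊥-elim)
open import Data.Fin.Base using (Fin; zero; suc; toℕ)
open import Data.Fin.Patterns using (0F; 1F; 2F; 3F)
open import Data.List.Base using (List; []; _∷_; length; lookup; applyUpTo)
open import Data.Maybe.Base as Maybe using (Maybe; just; nothing)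
open import Data.Nat.Base
open import Data.Nat.Induction using (<-rec)
open import Data.Nat.Properties
open import Data.Product.Base using (Σ-syntax; ∃-syntax; _×_; _,_; proj₁; proj₂; map₂)
open import Data.Sum.Base using (_⊎_; inj₁; inj₂; [_,_]′)
open import Data.Vec.Base as Vec using (Vec; []; _∷_)
open import Data.Vec.Relation.Binary.Pointwise.Inductive using (Pointwise; []; _∷_)
open import Defs
open import Function.Base using (_∘_; id; case_of_)
open import Level using (0ℓ)
open import Relation.Binary.PropositionalEquality
open import Relation.Nullary using (¬_; yes; no)
open import Relation.Unary using (Pred; _∈_; _∉_; _⊆_; _∪_; _≐_; ∁)

-- Computable functions

Computableⁿ : ∀ {n} → (Vec ℕ n → ℕ) → Set
Computableⁿ F = ∃[ p ] ∀ xs → p [ xs ]↓ F xs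

Computable₂ : (ℕ → ℕ → ℕ) → Set
Computable₂ f = ∃[ p ] ∀ x y → p [ x ∷ y ∷ [] ]↓ f x y

toComputable : ∀ {F} → Computableⁿ F → Computable (λ x → F (x ∷ []))
toComputable = map₂ λ r x → r (x ∷ [])

toComputable₂ : ∀ {F} → Computableⁿ F → Computable₂ (λ x y → F (x ∷ y ∷ []))
toComputable₂ = map₂ λ r x y → r (x ∷ y ∷ [])

computable-≗ : ∀ {f g} → f ≗ g → Computable f → Computable g
computable-≗ f≗g = map₂ λ r x → subst (_ [ _ ]↓_) (f≗g x) (r x)

var : ∀ {n} (i : Fin n) → Computableⁿ (λ xs → Vec.lookup xs i)
var i = projᴿ i , λ xs → proj↓ i

app : ∀ {n f} {F : Vec ℕ n → ℕ} →
      Computable f → Computableⁿ F → Computableⁿ (λ xs → f (F xs))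
app (p , r) (q , s) = compᴿ p (q ∷ []) , λ xs → comp↓ (s xs ∷ []) (r _)

app₂ : ∀ {n f} {F G : Vec ℕ n → ℕ} → Computable₂ f →
       Computableⁿ F → Computableⁿ G → Computableⁿ (λ xs → f (F xs) (G xs))
app₂ (p , r) (q , s) (q′ , s′) =
  compᴿ p (q ∷ q′ ∷ []) , λ xs → comp↓ (s xs ∷ s′ xs ∷ []) (r _ _)

suc-computable : Computable suc
suc-computable = sucᴿ , λ x → suc↓

const-computable : ∀ {n} k → Computableⁿ {n} (λ _ → k)
const-computable zero    = zeroᴿ , λ xs → zero↓
const-computable (suc k) = app suc-computable (const-computable k)

tabulate↓ : ∀ {m n xs} (q : Fin n → Rec m) (ys : Vec ℕ n) →
            (∀ i → q i [ xs ]↓ Vec.lookup ys i) →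
            Pointwise (λ q y → q [ xs ]↓ y) (Vec.tabulate q) ys
tabulate↓ q []       r = []
tabulate↓ q (y ∷ ys) r = r zero ∷ tabulate↓ (q ∘ suc) ys (r ∘ suc)

-- The recursion runs up to `K xs` with all of `xs` as parameters, so any variable can drive it and
-- no arguments have to be permuted.
prec-computable : ∀ {n} (f : ℕ → Vec ℕ n → ℕ) {G H K} →
  (∀ xs → G xs ≡ f 0 xs) → (∀ k xs → H (k ∷ f k xs ∷ xs) ≡ f (suc k) xs) →
  Computableⁿ G → Computableⁿ H → Computableⁿ K → Computableⁿ (λ xs → f (K xs) xs)
prec-computable f base step (p , r) (q , s) (t , u) =
  compᴿ (precᴿ p q) (t ∷ Vec.tabulate projᴿ) ,
  λ xs → comp↓ (u xs ∷ tabulate↓ projᴿ xs proj↓) (go _ xs)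
  where
  go : ∀ k xs → precᴿ p q [ k ∷ xs ]↓ f k xs
  go zero    xs = prec↓₀ (subst (p [ xs ]↓_) (base xs) (r xs))
  go (suc k) xs = prec↓₁ (go k xs) (subst (q [ _ ]↓_) (step k xs) (s _))

+-computable : Computable₂ _+_
+-computable = toComputable₂ (prec-computable (λ k xs → k + Vec.lookup xs 1F)
  (λ _ → refl) (λ _ _ → refl) (var 1F) (app suc-computable (var 1F)) (var 0F))

*-computable : Computable₂ _*_
*-computable = toComputable₂ (prec-computable (λ k xs → k * Vec.lookup xs 1F)
  (λ _ → refl) (λ _ _ → refl) (const-computable 0)
  (app₂ +-computable (var 3F) (var 1F)) (var 0F))

pred-computable : Computable pred
pred-computable = toComputable (prec-computable (λ k xs → pred k)
  (λ _ → refl) (λ _ _ → refl) (const-computable 0) (var 0F) (var 0F))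

∸-computable : Computable₂ _∸_
∸-computable = toComputable₂ (prec-computable (λ k xs → Vec.lookup xs 0F ∸ k)
  (λ _ → refl) (λ k xs → pred[m∸n]≡m∸[1+n] (Vec.lookup xs 0F) k)
  (var 0F) (app pred-computable (var 1F)) (var 1F))

ifZero : {A : Set} → ℕ → A → A → A
ifZero zero    x y = x
ifZero (suc _) x y = y

ifZero-computable : ∀ {n} {F G H : Vec ℕ n → ℕ} → Computableⁿ F → Computableⁿ G →
                    Computableⁿ H → Computableⁿ (λ xs → ifZero (F xs) (G xs) (H xs))
ifZero-computable F (q , s) (q′ , s′) = app₃ (toComp₃ (prec-computable
  (λ k xs → ifZero k (Vec.lookup xs 1F) (Vec.lookup xs 2F))
  (λ _ → refl) (λ _ _ → refl) (var 1F) (var (suc 3F)) (var 0F)))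
  where
  toComp₃ : ∀ {F} → Computableⁿ F → ∃[ p ] ∀ x y z → p [ x ∷ y ∷ z ∷ [] ]↓ F (x ∷ y ∷ z ∷ [])
  toComp₃ = map₂ λ r x y z → r _
  app₃ : ∃[ p ] (∀ x y z → p [ x ∷ y ∷ z ∷ [] ]↓ ifZero x y z) → _
  app₃ (p , r) = compᴿ p (proj₁ F ∷ q ∷ q′ ∷ []) ,
    λ xs → comp↓ (proj₂ F xs ∷ s xs ∷ s′ xs ∷ []) (r _ _ _)

-- Serves as a bounded universal quantifier: a sum of naturals vanishes exactly when every term
-- does.
sumBelow : (ℕ → ℕ) → ℕ → ℕ
sumBelow f zero    = 0
sumBelow f (suc n) = f n + sumBelow f n

sumBelow-computable : ∀ {n} {F : Vec ℕ (suc n) → ℕ} {K : Vec ℕ n → ℕ} →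
  Computableⁿ F → Computableⁿ K →
  Computableⁿ (λ xs → sumBelow (λ i → F (i ∷ xs)) (K xs))
sumBelow-computable {n} {F} (p , r) K = prec-computable
  (λ k xs → sumBelow (λ i → F (i ∷ xs)) k) (λ _ → refl) (λ _ _ → refl)
  (const-computable 0) (app₂ +-computable skip (var 1F)) K
  where
  -- A recursion step also receives the sum accumulated so far, which `F` must not see.
  skip : Computableⁿ {suc (suc n)} (λ ys → F (Vec.head ys ∷ Vec.tail (Vec.tail ys)))
  skip = compᴿ p (projᴿ 0F ∷ Vec.tabulate λ i → projᴿ (suc (suc i))) ,
    λ { (k ∷ y ∷ xs) → comp↓
      (proj↓ 0F ∷ tabulate↓ _ xs λ i → proj↓ (suc (suc i))) (r _) }

sumBelow≡0⇒ : ∀ f {n i} → sumBelow f n ≡ 0 → i < n → f i ≡ 0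
sumBelow≡0⇒ f {suc n} {i} eq (s≤s i≤n) with m≤n⇒m<n∨m≡n i≤n
... | inj₁ i<n  = sumBelow≡0⇒ f (m+n≡0⇒n≡0 (f n) eq) i<n
... | inj₂ refl = m+n≡0⇒m≡0 (f n) eq

sumBelow≡0⇐ : ∀ f n → (∀ i → i < n → f i ≡ 0) → sumBelow f n ≡ 0
sumBelow≡0⇐ f zero    eq = refl
sumBelow≡0⇐ f (suc n) eq =
  cong₂ _+_ (eq n ≤-refl) (sumBelow≡0⇐ f n λ i i<n → eq i (m<n⇒m<1+n i<n))

-- One of the two truncated differences is always 0, so this is the absolute difference, used as a
-- test for equality.
dist : ℕ → ℕ → ℕ
dist x y = (x ∸ y) + (y ∸ x)

dist-computable : Computable₂ dist
dist-computable = toComputable₂ (app₂ +-computable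
  (app₂ ∸-computable (var 0F) (var 1F)) (app₂ ∸-computable (var 1F) (var 0F)))

dist-self : ∀ x → dist x x ≡ 0
dist-self x = cong₂ _+_ (n∸n≡0 x) (n∸n≡0 x)

dist≡0⇒≡ : ∀ x y → dist x y ≡ 0 → x ≡ y
dist≡0⇒≡ x y eq = ≤-antisym (m∸n≡0⇒m≤n (m+n≡0⇒m≡0 (x ∸ y) eq))
                            (m∸n≡0⇒m≤n (m+n≡0⇒n≡0 (x ∸ y) eq))

-- Inverting the pairing function

triangle-computable : Computable triangle
triangle-computable = toComputable (prec-computable (λ k xs → triangle k)
  (λ _ → refl) (λ _ _ → refl) (const-computable 0)
  (app suc-computable (app₂ +-computable (var 0F) (var 1F))) (var 0F))

pair-computable : Computable₂ pair
pair-computable = toComputable₂ (app₂ +-computable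
  (app triangle-computable (app₂ +-computable (var 0F) (var 1F))) (var 1F))

triangle-mono-≤ : ∀ {m n} → m ≤ n → triangle m ≤ triangle n
triangle-mono-≤ z≤n       = z≤n
triangle-mono-≤ (s≤s m≤n) = s≤s (+-mono-≤ m≤n (triangle-mono-≤ m≤n))

-- The index of the diagonal on which Cantor's enumeration places `z`: the greatest `r` with
-- `triangle r ≤ z`.
root : ℕ → ℕ
root zero    = 0
root (suc z) = ifZero (triangle (suc (root z)) ∸ suc z) (suc (root z)) (root z)

root-computable : Computable root
root-computable = toComputable (prec-computable (λ k xs → root k)
  (λ _ → refl) (λ _ _ → refl) (const-computable 0)
  (ifZero-computable
    (app₂ ∸-computable (app triangle-computable (app suc-computable (var 1F)))
                       (app suc-computable (var 0F)))
    (app suc-computable (var 1F)) (var 1F)) (var 0F))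

root-bounds : ∀ z → triangle (root z) ≤ z × z < triangle (suc (root z))
root-bounds zero = z≤n , s≤s z≤n
root-bounds (suc z) with triangle (suc (root z)) ∸ suc z in eq | root-bounds z
-- No diagonal is skipped: `suc z` is at most the triangular number just reached, which lies
-- strictly below the next one.
... | zero  | _ , z< = m∸n≡0⇒m≤n eq ,
  ≤-<-trans z< (s≤s (m≤n+m (triangle (suc (root z))) (suc (root z))))
... | suc k | t≤ , _ = m≤n⇒m≤1+n t≤ ,
  m∸n≢0⇒n<m (λ eq′ → 0≢1+n (trans (sym eq′) eq))

-- By monotonicity, `b < a` would give `z < triangle (suc b) ≤ triangle a ≤ z`; the other case is
-- symmetric.
triangle-interval-unique : ∀ {a b z} → triangle a ≤ z → z < triangle (suc a) →
                           triangle b ≤ z → z < triangle (suc b) → a ≡ b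
triangle-interval-unique {a} {b} a≤ <a b≤ <b = ≤-antisym (below a≤ <b) (below b≤ <a)
  where
  below : ∀ {a b z} → triangle a ≤ z → z < triangle (suc b) → a ≤ b
  below a≤ <b = ≮⇒≥ λ b<a → <⇒≱ <b (≤-trans (triangle-mono-≤ b<a) a≤)

root-pair : ∀ x y → root (pair x y) ≡ x + y
root-pair x y = triangle-interval-unique
  (proj₁ (root-bounds (pair x y))) (proj₂ (root-bounds (pair x y)))
  (m≤m+n _ y)
  (subst (_< triangle (suc (x + y))) (+-comm y _)
    (s≤s (+-monoˡ-≤ (triangle (x + y)) (m≤n+m y x))))

π₂ π₁ : ℕ → ℕ
π₂ z = z ∸ triangle (root z)
π₁ z = root z ∸ π₂ z

π₂-computable : Computable π₂
π₂-computable = toComputable (app₂ ∸-computable (var 0F)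
  (app triangle-computable (app root-computable (var 0F))))

π₁-computable : Computable π₁
π₁-computable = toComputable (app₂ ∸-computable (app root-computable (var 0F))
  (app π₂-computable (var 0F)))

π₂-pair : ∀ x y → π₂ (pair x y) ≡ y
π₂-pair x y rewrite root-pair x y = m+n∸m≡n (triangle (x + y)) y

π₁-pair : ∀ x y → π₁ (pair x y) ≡ x
π₁-pair x y rewrite π₂-pair x y | root-pair x y = m+n∸n≡m x y

pair-π : ∀ z → pair (π₁ z) (π₂ z) ≡ z
pair-π z = trans (cong (λ r → triangle r + π₂ z) (m∸n+n≡m π₂≤root))
                 (m+[n∸m]≡n (proj₁ (root-bounds z)))
  where
  -- Ensures that the truncated subtraction in `π₁` loses nothing: `z` is below
  -- `triangle (suc (root z))`, hence at most `root z + triangle (root z)`.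
  π₂≤root : π₂ z ≤ root z
  π₂≤root = ≤-trans
    (∸-monoˡ-≤ (triangle (root z)) (≤-pred (proj₂ (root-bounds z))))
    (≤-reflexive (m+n∸n≡m (root z) (triangle (root z))))

pair-injective : ∀ {x y x′ y′} → pair x y ≡ pair x′ y′ → x ≡ x′ × y ≡ y′
pair-injective {x} {y} {x′} {y′} eq =
  trans (sym (π₁-pair x y)) (trans (cong π₁ eq) (π₁-pair x′ y′)) ,
  trans (sym (π₂-pair x y)) (trans (cong π₂ eq) (π₂-pair x′ y′))

-- Codes of strings

encode-injective : ∀ σ τ → encode σ ≡ encode τ → σ ≡ τ
encode-injective []      []      eq = refl
encode-injective (x ∷ σ) (y ∷ τ) eq with pair-injective {x} (suc-injective eq)
... | x≡y , σ≡τ = cong₂ _∷_ x≡y (encode-injective σ τ σ≡τ)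

encode-surjective : ∀ n → ∃[ σ ] encode σ ≡ n
encode-surjective = <-rec _ λ where
  zero    rec → [] , refl
  -- The tail has code `π₂ m`, which is `m` minus a triangular number and so below `suc m`.
  (suc m) rec → let σ , eq = rec (s≤s (m∸n≤m m (triangle (root m)))) in
    π₁ m ∷ σ , cong suc (trans (cong (pair (π₁ m)) eq) (pair-π m))

encode₂-injective : ∀ a b → encode₂ a ≡ encode₂ b → a ≡ b
encode₂-injective (σ , τ) (σ′ , τ′) eq with pair-injective {encode σ} eq
... | eq₁ , eq₂ = cong₂ _,_ (encode-injective σ σ′ eq₁) (encode-injective τ τ′ eq₂)

encode₂-surjective : ∀ n → ∃[ a ] encode₂ a ≡ n
encode₂-surjective n =
  let σ , eq₁ = encode-surjective (π₁ n)
      τ , eq₂ = encode-surjective (π₂ n)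
  in (σ , τ) , trans (cong₂ pair eq₁ eq₂) (pair-π n)

-- The value 0 of nth and at means "out of range"; entries are shifted by one.
nth : List ℕ → ℕ → ℕ
nth []      i       = 0
nth (x ∷ σ) zero    = suc x
nth (x ∷ σ) (suc i) = nth σ i

-- Acts on codes of strings. Since `π₂ (pred 0)` is 0, the empty string stays empty.
drop : ℕ → ℕ → ℕ
drop zero    c = c
drop (suc i) c = π₂ (pred (drop i c))

at : ℕ → ℕ → ℕ
at c i = ifZero (drop i c) 0 (suc (π₁ (pred (drop i c))))

drop-computable : Computable₂ drop
drop-computable = toComputable₂ (prec-computable (λ k xs → drop k (Vec.lookup xs 1F))
  (λ _ → refl) (λ _ _ → refl) (var 1F)
  (app π₂-computable (app pred-computable (var 1F))) (var 0F))

at-computable : Computable₂ at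
at-computable = toComputable₂ (ifZero-computable tail (const-computable 0)
  (app suc-computable (app π₁-computable (app pred-computable tail))))
  where
  tail : Computableⁿ (λ xs → drop (Vec.lookup xs 1F) (Vec.lookup xs 0F))
  tail = app₂ drop-computable (var 1F) (var 0F)

-- Primitive recursion makes `drop` peel the last step off the outside; induction on a string has to
-- remove its head first.
drop-suc : ∀ i c → drop (suc i) c ≡ drop i (π₂ (pred c))
drop-suc zero    c = refl
drop-suc (suc i) c = cong (π₂ ∘ pred) (drop-suc i c)

drop-0 : ∀ i → drop i 0 ≡ 0
drop-0 zero    = refl
drop-0 (suc i) = cong (π₂ ∘ pred) (drop-0 i)

at-encode : ∀ σ i → at (encode σ) i ≡ nth σ i
at-encode []      i    rewrite drop-0 i = refl
at-encode (x ∷ σ) zero = cong suc (π₁-pair x (encode σ))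
at-encode (x ∷ σ) (suc i)
  rewrite drop-suc i (encode (x ∷ σ)) | π₂-pair x (encode σ) = at-encode σ i

-- A code exceeds every position of its string, so sums up to `encode σ` inspect all of `σ` without
-- computing its length.
nth-bounded : ∀ σ i → nth σ i ≡ 0 ⊎ i < encode σ
nth-bounded []      i       = inj₁ refl
nth-bounded (x ∷ σ) zero    = inj₂ (s≤s z≤n)
nth-bounded (x ∷ σ) (suc i) with nth-bounded σ i
... | inj₁ eq = inj₁ eq
... | inj₂ i< = inj₂ (s≤s (≤-trans i< (m≤n+m (encode σ) _)))

nth-toℕ : ∀ σ (i : Fin (length σ)) → nth σ (toℕ i) ≡ suc (lookup σ i)
nth-toℕ (x ∷ σ) zero    = refl
nth-toℕ (x ∷ σ) (suc i) = nth-toℕ σ i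

⊏⇒nth : ∀ σ {h} → σ ⊏ h → ∀ i → nth σ i ≡ 0 ⊎ nth σ i ≡ suc (h i)
⊏⇒nth []      σ⊏h i       = inj₁ refl
⊏⇒nth (x ∷ σ) σ⊏h zero    = inj₂ (cong suc (σ⊏h zero))
⊏⇒nth (x ∷ σ) σ⊏h (suc i) = ⊏⇒nth σ (σ⊏h ∘ suc) i

nth⇒⊏ : ∀ σ {h} → (∀ i → nth σ i ≡ 0 ⊎ nth σ i ≡ suc (h i)) → σ ⊏ h
nth⇒⊏ σ agree i with agree (toℕ i)
... | inj₁ eq = ⊥-elim (0≢1+n (trans (sym eq) (nth-toℕ σ i)))
... | inj₂ eq = suc-injective (trans (sym (nth-toℕ σ i)) eq)

nth-prefix : ∀ h {N i} → i < N → nth (applyUpTo h N) i ≡ suc (h i)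
nth-prefix h {suc N} {zero}  i<N       = refl
nth-prefix h {suc N} {suc i} (s≤s i<N) = nth-prefix (h ∘ suc) i<N

prefix-⊏ : ∀ h N → applyUpTo h N ⊏ h
prefix-⊏ h (suc N) zero    = refl
prefix-⊏ h (suc N) (suc i) = prefix-⊏ (h ∘ suc) N i

-- A test succeeds when its value is 0.  On long prefixes σ of a point, extension ρ σ
-- and conflict ρ σ decide from opposite sides whether ρ is a prefix of that point:
-- the former vanishes if it is, the latter is nonzero if it is not.

sumAt : (ℕ → ℕ → ℕ) → ℕ → ℕ → ℕ
sumAt t r s = sumBelow (λ i → t (at r i) (at s i)) r

sumAt-computable : ∀ {t} → Computable₂ t → Computable₂ (sumAt t)
sumAt-computable t = toComputable₂ (sumBelow-computable
  (app₂ t (app₂ at-computable (var 1F) (var 0F)) (app₂ at-computable (var 2F) (var 0F)))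
  (var 0F))

sumAt≡0⇒ : ∀ t ρ σ {i} → sumAt t (encode ρ) (encode σ) ≡ 0 → i < encode ρ →
           t (nth ρ i) (nth σ i) ≡ 0
sumAt≡0⇒ t ρ σ {i} eq i< =
  subst₂ (λ x y → t x y ≡ 0) (at-encode ρ i) (at-encode σ i) (sumBelow≡0⇒ _ eq i<)

sumAt≡0⇐ : ∀ t ρ σ → (∀ i → i < encode ρ → t (nth ρ i) (nth σ i) ≡ 0) →
           sumAt t (encode ρ) (encode σ) ≡ 0
sumAt≡0⇐ t ρ σ eq = sumBelow≡0⇐ _ (encode ρ) λ i i< →
  subst₂ (λ x y → t x y ≡ 0) (sym (at-encode ρ i)) (sym (at-encode σ i)) (eq i i<)

-- On shifted entries, `unmatched` is nonzero where the first string has an entry that the second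
-- lacks or contradicts, `clash` only where both have entries and these differ.
unmatched clash extension conflict : ℕ → ℕ → ℕ
unmatched x y = x * dist x y
clash     x y = x * (y * dist x y)
extension = sumAt unmatched
conflict  = sumAt clash

extension-computable : Computable₂ extension
extension-computable = sumAt-computable (toComputable₂
  (app₂ *-computable (var 0F) (app₂ dist-computable (var 0F) (var 1F))))

conflict-computable : Computable₂ conflict
conflict-computable = sumAt-computable (toComputable₂
  (app₂ *-computable (var 0F)
    (app₂ *-computable (var 1F) (app₂ dist-computable (var 0F) (var 1F)))))

extension-sound : ∀ ρ σ {h} → extension (encode ρ) (encode σ) ≡ 0 → σ ⊏ h → ρ ⊏ h
extension-sound ρ σ {h} ext σ⊏h = nth⇒⊏ ρ agree
  where
  agree : ∀ i → nth ρ i ≡ 0 ⊎ nth ρ i ≡ suc (h i)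
  agree i with nth-bounded ρ i
  ... | inj₁ eq = inj₁ eq
  ... | inj₂ i< with m*n≡0⇒m≡0∨n≡0 (nth ρ i) (sumAt≡0⇒ unmatched ρ σ ext i<)
  ... | inj₁ eq = inj₁ eq
  ... | inj₂ eq rewrite dist≡0⇒≡ (nth ρ i) (nth σ i) eq = ⊏⇒nth σ σ⊏h i

extension-complete : ∀ ρ {h N} → ρ ⊏ h → encode ρ ≤ N →
                     extension (encode ρ) (encode (applyUpTo h N)) ≡ 0
extension-complete ρ {h} {N} ρ⊏h ρ≤N = sumAt≡0⇐ unmatched ρ (applyUpTo h N) term
  where
  term : ∀ i → i < encode ρ → unmatched (nth ρ i) (nth (applyUpTo h N) i) ≡ 0
  term i i< rewrite nth-prefix h (<-≤-trans i< ρ≤N) with ⊏⇒nth ρ {h} ρ⊏h i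
  ... | inj₁ eq rewrite eq = refl
  ... | inj₂ eq rewrite eq | dist-self (h i) = *-zeroʳ (h i)

conflict-sound : ∀ ρ σ {h} → ρ ⊏ h → σ ⊏ h → conflict (encode ρ) (encode σ) ≡ 0
conflict-sound ρ σ {h} ρ⊏h σ⊏h = sumAt≡0⇐ clash ρ σ term
  where
  term : ∀ i → i < encode ρ → clash (nth ρ i) (nth σ i) ≡ 0
  term i _ with ⊏⇒nth ρ {h} ρ⊏h i | ⊏⇒nth σ {h} σ⊏h i
  ... | inj₁ eq | _        rewrite eq = refl
  ... | inj₂ _  | inj₁ eq  rewrite eq = *-zeroʳ (nth ρ i)
  ... | inj₂ eq | inj₂ eq′ rewrite eq | eq′ | dist-self (h i) | *-zeroʳ (h i) = *-zeroʳ (h i)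

conflict-complete : ∀ ρ {h N} → ¬ ρ ⊏ h → encode ρ ≤ N →
                    conflict (encode ρ) (encode (applyUpTo h N)) ≢ 0
conflict-complete ρ {h} {N} ¬ρ⊏h ρ≤N sum≡0 = ¬ρ⊏h (nth⇒⊏ ρ agree)
  where
  agree : ∀ i → nth ρ i ≡ 0 ⊎ nth ρ i ≡ suc (h i)
  agree i with nth-bounded ρ i
  ... | inj₁ eq = inj₁ eq
  ... | inj₂ i< with sumAt≡0⇒ clash ρ (applyUpTo h N) sum≡0 i<
  ... | term rewrite nth-prefix h (<-≤-trans i< ρ≤N) with m*n≡0⇒m≡0∨n≡0 (nth ρ i) term
  ... | inj₁ eq = inj₁ eq
  -- The prefix has the nonzero entry `suc (h i)` here, and `suc (h i) * d` unfolds to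
  -- `d + h i * d`, so the distance `d` vanishes.
  ... | inj₂ eq = inj₂ (dist≡0⇒≡ (nth ρ i) (suc (h i)) (m+n≡0⇒m≡0 _ eq))

-- Effectively open sets

-- Code 0 is kept for `nothing`, which stands for the empty set; thus an empty c.e. set is also
-- given by a total sequence.
code? : {A : Set} → (A → ℕ) → Maybe A → ℕ
code? code = Maybe.maybe (suc ∘ code) 0

basic? : Maybe (List ℕ × List ℕ) → Pred (Baire × Baire) 0ℓ
basic? nothing        x = ⊥
basic? (just (σ , τ)) x = x ∈ [ σ ]×[ τ ]

onComponents : (ℕ → ℕ → ℕ) → ℕ → ℕ → ℕ
onComponents t v w = t (π₁ (pred v)) (π₁ w) + t (π₂ (pred v)) (π₂ w)

-- Extension is required in both components, hence the sum; a conflict in one component suffices for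
-- separation, hence the negation `1 ∸_` of a sum. For `v = 0`, the empty set, the first test fails
-- and the second succeeds.
extension? separation? : ℕ → ℕ → ℕ
extension?  v w = ifZero v 1 (onComponents extension v w)
separation? v w = ifZero v 0 (1 ∸ onComponents conflict v w)

onComponents-computable : ∀ {t} → Computable₂ t → Computable₂ (onComponents t)
onComponents-computable t = toComputable₂ (app₂ +-computable
  (app₂ t (app π₁-computable (app pred-computable (var 0F))) (app π₁-computable (var 1F)))
  (app₂ t (app π₂-computable (app pred-computable (var 0F))) (app π₂-computable (var 1F))))

onComponents-encode : ∀ t ρ ρ′ σ τ →
  onComponents t (suc (encode₂ (ρ , ρ′))) (encode₂ (σ , τ)) ≡
  t (encode ρ) (encode σ) + t (encode ρ′) (encode τ)
onComponents-encode t ρ ρ′ σ τ = cong₂ _+_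
  (cong₂ t (π₁-pair (encode ρ) (encode ρ′)) (π₁-pair (encode σ) (encode τ)))
  (cong₂ t (π₂-pair (encode ρ) (encode ρ′)) (π₂-pair (encode σ) (encode τ)))

extension?-computable : Computable₂ extension?
extension?-computable = toComputable₂ (ifZero-computable (var 0F) (const-computable 1)
  (app₂ (onComponents-computable extension-computable) (var 0F) (var 1F)))

separation?-computable : Computable₂ separation?
separation?-computable = toComputable₂ (ifZero-computable (var 0F) (const-computable 0)
  (app₂ ∸-computable (const-computable 1)
    (app₂ (onComponents-computable conflict-computable) (var 0F) (var 1F))))

-- Tests on long prefixes of a point

Eventually : (ℕ → Set) → Set
Eventually P = ∃[ N₀ ] ∀ N → N₀ ≤ N → P N

eventually-below : ∀ {P : ℕ → ℕ → Set} k → (∀ m → m < k → Eventually (P m)) →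
                   Eventually (λ N → ∀ m → m < k → P m N)
eventually-below zero    ev = 0 , λ N _ m ()
eventually-below {P} (suc k) ev
  with ev k ≤-refl | eventually-below k (λ m m<k → ev m (m<n⇒m<1+n m<k))
... | N₁ , last | N₂ , rest = N₁ + N₂ , all
  where
  all : ∀ N → N₁ + N₂ ≤ N → ∀ m → m < suc k → P m N
  all N N≥ m (s≤s m≤k) with m≤n⇒m<n∨m≡n m≤k
  ... | inj₁ m<k  = rest N (m+n≤o⇒n≤o N₁ N≥) m m<k
  ... | inj₂ refl = last N (m+n≤o⇒m≤o N₁ N≥)

prefixes : Baire × Baire → ℕ → List ℕ × List ℕ
prefixes (h , g) N = applyUpTo h N , applyUpTo g N

extension?-sound : ∀ v a {x} → extension? (code? encode₂ v) (encode₂ a) ≡ 0 →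
                   x ∈ [ proj₁ a ]×[ proj₂ a ] → x ∈ basic? v
extension?-sound (just (ρ , ρ′)) (σ , τ) {h , g} ext (σ⊏h , τ⊏g) =
  extension-sound ρ σ {h} (m+n≡0⇒m≡0 _ sum≡0) σ⊏h ,
  extension-sound ρ′ τ {g} (m+n≡0⇒n≡0 (extension (encode ρ) (encode σ)) sum≡0) τ⊏g
  where
  sum≡0 : extension (encode ρ) (encode σ) + extension (encode ρ′) (encode τ) ≡ 0
  sum≡0 = trans (sym (onComponents-encode extension ρ ρ′ σ τ)) ext

extension?-complete : ∀ v x → x ∈ basic? v →
  Eventually λ N → extension? (code? encode₂ v) (encode₂ (prefixes x N)) ≡ 0
extension?-complete (just (ρ , ρ′)) (h , g) (ρ⊏h , ρ′⊏g) = encode ρ + encode ρ′ , λ N N≥ →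
  trans (onComponents-encode extension ρ ρ′ (applyUpTo h N) (applyUpTo g N))
        (cong₂ _+_ (extension-complete ρ ρ⊏h (m+n≤o⇒m≤o _ N≥))
                   (extension-complete ρ′ ρ′⊏g (m+n≤o⇒n≤o (encode ρ) N≥)))

separation?-sound : ∀ v a {x} → separation? (code? encode₂ v) (encode₂ a) ≡ 0 →
                    x ∈ [ proj₁ a ]×[ proj₂ a ] → x ∉ basic? v
separation?-sound (just (ρ , ρ′)) (σ , τ) {h , g} sep (σ⊏h , τ⊏g) (ρ⊏h , ρ′⊏g) =
  1+n≢0 (trans (sym (cong (1 ∸_) sum≡0)) sep)
  where
  sum≡0 : onComponents conflict (suc (encode₂ (ρ , ρ′))) (encode₂ (σ , τ)) ≡ 0
  sum≡0 = trans (onComponents-encode conflict ρ ρ′ σ τ)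
                (cong₂ _+_ (conflict-sound ρ σ {h} ρ⊏h σ⊏h) (conflict-sound ρ′ τ {g} ρ′⊏g τ⊏g))

-- Basic sets are closed as well as open: a point outside disagrees with `ρ` or with `ρ′`, and every
-- long prefix shows it. Excluded middle selects the component.
separation?-complete : ExcludedMiddle 0ℓ → ∀ v x → x ∉ basic? v →
  Eventually λ N → separation? (code? encode₂ v) (encode₂ (prefixes x N)) ≡ 0
separation?-complete em nothing         x       x∉ = 0 , λ _ _ → refl
separation?-complete em (just (ρ , ρ′)) (h , g) x∉ = encode ρ + encode ρ′ , λ N N≥ →
  m≤n⇒m∸n≡0 (n≢0⇒n>0 λ eq → clashes N N≥
    (trans (sym (onComponents-encode conflict ρ ρ′ (applyUpTo h N) (applyUpTo g N))) eq))
  where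
  clashes : ∀ N → encode ρ + encode ρ′ ≤ N →
            conflict (encode ρ) (encode (applyUpTo h N)) +
            conflict (encode ρ′) (encode (applyUpTo g N)) ≢ 0
  clashes N N≥ sum≡0 with em {ρ ⊏ h}
  ... | no ρ⊄h  = conflict-complete ρ ρ⊄h (m+n≤o⇒m≤o _ N≥) (m+n≡0⇒m≡0 _ sum≡0)
  ... | yes ρ⊏h = conflict-complete ρ′ (λ ρ′⊏g → x∉ (ρ⊏h , ρ′⊏g))
                    (m+n≤o⇒n≤o (encode ρ) N≥)
                    (m+n≡0⇒n≡0 (conflict (encode ρ) (encode (applyUpTo h N))) sum≡0)

-- C.e. sets from computable tests

ce-projection : ExcludedMiddle 0ℓ → ∀ {R} → Computable₂ R →
                CE encode₂ (λ a → ∃[ n ] R n (encode₂ a) ≡ 0)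
ce-projection em {R} R-comp with em {∃[ a ] ∃[ n ] R n (encode₂ a) ≡ 0}
... | no  none = inj₁ λ a a∈ → none (a , a∈)
... | yes (a₀ , a₀∈) = inj₂ (e , computable-≗ (λ k → sym (encode-e k)) listed-computable
                               , (λ {a} → complete {a}) , λ { (k , refl) → sound k })
  where
  listed : ℕ → ℕ
  -- Stage `k` codes a witness and a candidate; the candidate is listed if the test succeeds, and
  -- the default `a₀` otherwise.
  listed k = ifZero (R (π₁ k) (π₂ k)) (π₂ k) (encode₂ a₀)

  listed-computable : Computable listed
  listed-computable = toComputable (ifZero-computable
    (app₂ R-comp (app π₁-computable (var 0F)) (app π₂-computable (var 0F)))
    (app π₂-computable (var 0F)) (const-computable (encode₂ a₀)))

  e : ℕ → List ℕ × List ℕ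
  e k = proj₁ (encode₂-surjective (listed k))

  encode-e : ∀ k → encode₂ (e k) ≡ listed k
  encode-e k = proj₂ (encode₂-surjective (listed k))

  sound : ∀ k → ∃[ n ] R n (encode₂ (e k)) ≡ 0
  sound k rewrite encode-e k with R (π₁ k) (π₂ k) in eq
  ... | zero  = π₁ k , eq
  ... | suc _ = a₀∈

  complete : ∀ {a} → ∃[ n ] R n (encode₂ a) ≡ 0 → ∃[ k ] e k ≡ a
  complete {a} (n , Rna) = k , encode₂-injective (e k) a (trans (encode-e k) listed-k)
    where
    k = pair n (encode₂ a)
    listed-k : listed k ≡ encode₂ a
    listed-k rewrite π₁-pair n (encode₂ a) | π₂-pair n (encode₂ a) | Rna = refl

ce⇒sequence : ∀ {A : Set} {code : A → ℕ} {S} → CE code S →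
  Σ[ v ∈ (ℕ → Maybe A) ] Computable (code? code ∘ v) × S ≐ (λ a → ∃[ n ] v n ≡ just a)
ce⇒sequence (inj₁ empty) =
  (λ _ → nothing) , toComputable (const-computable 0) , (λ {a} → ⊥-elim ∘ empty a) , λ ()
ce⇒sequence (inj₂ (e , e-comp , S⊆ , ⊆S)) =
  just ∘ e , toComputable (app suc-computable (app e-comp (var 0F))) ,
  (λ a∈S → map₂ (cong just) (S⊆ a∈S)) , λ { (n , refl) → ⊆S (n , refl) }

-- Open sets as unions of computable sequences

Sequence : Set
Sequence = Σ[ v ∈ (ℕ → Maybe (List ℕ × List ℕ)) ] Computable (code? encode₂ ∘ v)

⋃ : Sequence → Pred (Baire × Baire) 0ℓ
⋃ (v , _) x = ∃[ n ] x ∈ basic? (v n)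

Σ⁰₁⇒⋃ : ∀ {P} → N².Σ⁰₁ P → ∃[ s ] P ≐ ⋃ s
Σ⁰₁⇒⋃ {P} (W , ce , P⊆ , ⊆P) with ce⇒sequence ce
... | v , v-comp , W⊆ , ⊆W = (v , v-comp) , to , from
  where
  to : P ⊆ ⋃ (v , v-comp)
  to {x} x∈P = let a , a∈W , x∈a = P⊆ x∈P
                   n , eq = W⊆ a∈W
               in n , subst (λ m → x ∈ basic? m) (sym eq) x∈a

  from : ⋃ (v , v-comp) ⊆ P
  from (n , x∈) with v n in eq
  ... | just a = ⊆P (a , ⊆W (n , eq) , x∈)

-- Each string is paired with `[]`, of code 0, which puts no condition on the second coordinate.
cylinder : ∀ {U} → N.Σ⁰₁ U → ∃[ s ] U ∘ proj₁ ≐ ⋃ s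
cylinder {U} (W , ce , U⊆ , ⊆U) with ce⇒sequence ce
... | v , v-comp , W⊆ , ⊆W =
  (v×[] , computable-≗ (λ n → code-v×[] (v n)) (toComputable (ifZero-computable c
    (const-computable 0) (app suc-computable (app₂ pair-computable
      (app pred-computable c) (const-computable 0)))))) , to , from
  where
  c : Computableⁿ {1} (λ xs → code? encode (v (Vec.lookup xs 0F)))
  c = app v-comp (var 0F)

  v×[] : ℕ → Maybe (List ℕ × List ℕ)
  v×[] n = Maybe.map (_, []) (v n)

  code-v×[] : ∀ m → ifZero (code? encode m) 0 (suc (pair (pred (code? encode m)) 0)) ≡
                    code? encode₂ (Maybe.map (_, []) m)
  code-v×[] nothing  = refl
  code-v×[] (just σ) = refl

  to : U ∘ proj₁ ⊆ λ x → ∃[ n ] x ∈ basic? (v×[] n)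
  to {x} x∈U = let σ , σ∈W , σ⊏h = U⊆ x∈U
                   n , eq = W⊆ σ∈W
               in n , subst (λ m → x ∈ basic? (Maybe.map (_, []) m)) (sym eq) (σ⊏h , λ ())

  from : (λ x → ∃[ n ] x ∈ basic? (v×[] n)) ⊆ U ∘ proj₁
  from (n , x∈) with v n in eq
  ... | just σ = ⊆U (σ , ⊆W (n , eq) , proj₁ x∈)

union : ∀ s t → ∃[ u ] ⋃ s ∪ ⋃ t ≐ ⋃ u
union (v , v-comp) (w , w-comp) =
  (vw , computable-≗ (λ k → sym (code-ifZero (π₁ k))) (toComputable (ifZero-computable
    (app π₁-computable (var 0F))
    (app v-comp (app π₂-computable (var 0F)))
    (app w-comp (app π₂-computable (var 0F)))))) , to , from
  where
  vw : ℕ → Maybe (List ℕ × List ℕ)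
  -- Every nonzero tag selects `w`; the repetitions do not change the union.
  vw k = ifZero (π₁ k) (v (π₂ k)) (w (π₂ k))

  code-ifZero : ∀ k {x y} → code? encode₂ (ifZero k x y) ≡
                            ifZero k (code? encode₂ x) (code? encode₂ y)
  code-ifZero zero    = refl
  code-ifZero (suc _) = refl

  vw-pair : ∀ i n → vw (pair i n) ≡ ifZero i (v n) (w n)
  vw-pair i n rewrite π₁-pair i n | π₂-pair i n = refl

  to : ⋃ (v , v-comp) ∪ ⋃ (w , w-comp) ⊆ λ x → ∃[ n ] x ∈ basic? (vw n)
  to {x} (inj₁ (n , x∈)) = pair 0 n , subst (λ m → x ∈ basic? m) (sym (vw-pair 0 n)) x∈
  to {x} (inj₂ (n , x∈)) = pair 1 n , subst (λ m → x ∈ basic? m) (sym (vw-pair 1 n)) x∈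

  from : (λ x → ∃[ n ] x ∈ basic? (vw n)) ⊆ ⋃ (v , v-comp) ∪ ⋃ (w , w-comp)
  from (k , x∈) with π₁ k
  ... | zero  = inj₁ (π₂ k , x∈)
  ... | suc _ = inj₂ (π₂ k , x∈)

-- Comparing entry stages of two open sets

Before : Sequence → Sequence → (ℕ → ℕ) → Pred (Baire × Baire) 0ℓ
Before (v , _) (w , _) b x = ∃[ n ] x ∈ basic? (v n) × (∀ m → m < b n → x ∉ basic? (w m))

-- Only finitely many basic sets must be avoided, so one prefix pair certifies membership: it
-- extends `v n` and is separated from each `w m` with `m < b n`.
before-Σ⁰₁ : ExcludedMiddle 0ℓ → ∀ s t {b} → Computable b → N².Σ⁰₁ (Before s t b)
before-Σ⁰₁ em (v , v-comp) (w , w-comp) {b} b-comp =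
  (λ a → ∃[ n ] R n (encode₂ a) ≡ 0) , ce-projection em R-computable , to , from
  where
  R : ℕ → ℕ → ℕ
  R n a = extension? (code? encode₂ (v n)) a +
          sumBelow (λ m → separation? (code? encode₂ (w m)) a) (b n)

  R-computable : Computable₂ R
  R-computable = toComputable₂ (app₂ +-computable
    (app₂ extension?-computable (app v-comp (var 0F)) (var 1F))
    (sumBelow-computable
      (app₂ separation?-computable (app w-comp (var 0F)) (var 2F))
      (app b-comp (var 0F))))

  to : Before (v , v-comp) (w , w-comp) b ⊆
       λ x → ∃[ a ] (∃[ n ] R n (encode₂ a) ≡ 0) × x ∈ [ proj₁ a ]×[ proj₂ a ]
  to {x} (n , x∈ , x∉) =
    let N₁ , inside = extension?-complete (v n) x x∈
        N₂ , outside = eventually-below (b n) λ m m<b → separation?-complete em (w m) x (x∉ m m<b)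
        N = N₁ + N₂
    in prefixes x N ,
       (n , cong₂ _+_ (inside N (m≤m+n N₁ N₂)) (sumBelow≡0⇐ _ (b n) (outside N (m≤n+m N₂ N₁)))) ,
       prefix-⊏ (proj₁ x) N , prefix-⊏ (proj₂ x) N

  from : (λ x → ∃[ a ] (∃[ n ] R n (encode₂ a) ≡ 0) × x ∈ [ proj₁ a ]×[ proj₂ a ]) ⊆
         Before (v , v-comp) (w , w-comp) b
  from {x} (a , (n , Rna) , x∈a) =
    n , extension?-sound (v n) a (m+n≡0⇒m≡0 _ Rna) x∈a ,
    λ m m<b → separation?-sound (w m) a
      (sumBelow≡0⇒ _ (m+n≡0⇒n≡0 (extension? (code? encode₂ (v n)) (encode₂ a)) Rna) m<b) x∈a

Σ⁰₁-resp-≐ : ∀ {P Q} → P ≐ Q → N².Σ⁰₁ P → N².Σ⁰₁ Q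
Σ⁰₁-resp-≐ (P⊆Q , Q⊆P) (W , ce , P⊆ , ⊆P) = W , ce , P⊆ ∘ Q⊆P , P⊆Q ∘ ⊆P

Δ⁰₁-between : ExcludedMiddle 0ℓ → ∀ s t → (∀ x → x ∈ ⋃ s ∪ ⋃ t) →
              ∃[ Q ] N².Δ⁰₁ Q × Q ⊆ ⋃ s × ∁ Q ⊆ ⋃ t
Δ⁰₁-between em s@(v , _) t@(w , _) cover =
  Q ,
  (before-Σ⁰₁ em s t (toComputable (var 0F)) ,
   Σ⁰₁-resp-≐ ((λ {x} → Q′⊆∁Q {x}) , λ {x} → ∁Q⊆Q′ {x}) (before-Σ⁰₁ em t s suc-computable)) ,
  (λ (n , x∈ , _) → n , x∈) ,
  λ {x} x∉Q → let n , x∈ , _ = ∁Q⊆Q′ {x} x∉Q in n , x∈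
  where
  Q Q′ : Pred (Baire × Baire) 0ℓ
  -- The bounds settle ties: a point entering both sequences first at the same stage belongs to `Q`
  -- by `id` and is barred from `Q′` by `suc`.
  Q  = Before s t id
  Q′ = Before t s suc

  Q′⊆∁Q : Q′ ⊆ ∁ Q
  Q′⊆∁Q (n′ , x∈w , x∉v) (n , x∈v , x∉w) with n <? suc n′
  ... | yes n≤n′ = x∉v n n≤n′ x∈v
  ... | no  n≰n′ = x∉w n′ (≮⇒≥ n≰n′) x∈w

  -- A first entry into either sequence would put `x` into `Q` or `Q′`. At each stage `v` is
  -- excluded before `w`, because `Q′` demands avoidance of `v` at that very stage too.
  undecidedBelow : ∀ {x} → x ∉ Q → x ∉ Q′ → ∀ n m → m < n →
                   x ∉ basic? (v m) × x ∉ basic? (w m)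
  undecidedBelow {x} x∉Q x∉Q′ (suc n) m (s≤s m≤n) with m≤n⇒m<n∨m≡n m≤n
  ... | inj₁ m<n  = undecidedBelow x∉Q x∉Q′ n m m<n
  ... | inj₂ refl = x∉v , λ x∈w → x∉Q′ (n , x∈w , avoids)
    where
    ih = undecidedBelow x∉Q x∉Q′ n
    x∉v : x ∉ basic? (v n)
    x∉v x∈v = x∉Q (n , x∈v , λ m m<n → proj₂ (ih m m<n))
    avoids : ∀ m → m < suc n → x ∉ basic? (v m)
    avoids m (s≤s m≤n) with m≤n⇒m<n∨m≡n m≤n
    ... | inj₁ m<n  = proj₁ (ih m m<n)
    ... | inj₂ refl = x∉v

  ∁Q⊆Q′ : ∁ Q ⊆ Q′
  ∁Q⊆Q′ {x} x∉Q with em {x ∈ Q′}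
  ... | yes x∈Q′ = x∈Q′
  ... | no  x∉Q′ = ⊥-elim ([ (λ (n , x∈v) → proj₁ (undecidedBelow x∉Q x∉Q′ (suc n) n ≤-refl) x∈v)
                           , (λ (n , x∈w) → proj₂ (undecidedBelow x∉Q x∉Q′ (suc n) n ≤-refl) x∈w)
                           ]′ (cover x))

-- Sections over a singleton

Σ⁰₁-resp-≗ : ∀ {P} → N².Σ⁰₁ P → ∀ {h k g} → h ≗ k → P (h , g) → P (k , g)
Σ⁰₁-resp-≗ (W , ce , P⊆ , ⊆P) h≗k hg∈P =
  let (σ , τ) , a∈W , σ⊏h , τ⊏g = P⊆ hg∈P
  in ⊆P ((σ , τ) , a∈W , (λ i → trans (σ⊏h i) (h≗k (toℕ i))) , τ⊏g)

theorem17 : ExcludedMiddle 0ℓ → (f : Baire) → Π⁰₁-Singleton f → StronglyRelativizesΔ⁰₁ f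
theorem17 em f isolated P ((A , A-Σ , P⊆A , A⊆P) , (B , B-Σ , ∁P⊆B , B⊆∁P)) =
  let s , A⊆s , s⊆A = Σ⁰₁⇒⋃ A-Σ
      t , B⊆t , t⊆B = Σ⁰₁⇒⋃ B-Σ
      u , f≢⊆u , u⊆f≢ = cylinder isolated
      t∪u , t∪u⊆ , ⊆t∪u = union t u

      A∪B : ∀ g → A (f , g) ⊎ B (f , g)
      A∪B g = case em {P g} of λ where
        (yes g∈P) → inj₁ (P⊆A g∈P)
        (no  g∉P) → inj₂ (∁P⊆B g∉P)

      cover : ∀ x → x ∈ ⋃ s ∪ ⋃ t∪u
      cover (h , g) = case em {h ≗ f} of λ where
        (no  h≢f) → inj₂ (t∪u⊆ (inj₂ (f≢⊆u h≢f)))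
        -- `h` agrees with `f` only pointwise, so membership over `f` is carried to `h` by openness.
        (yes h≗f) → [ inj₁ ∘ A⊆s ∘ Σ⁰₁-resp-≗ A-Σ (sym ∘ h≗f)
                    , inj₂ ∘ t∪u⊆ ∘ inj₁ ∘ B⊆t ∘ Σ⁰₁-resp-≗ B-Σ (sym ∘ h≗f) ]′ (A∪B g)

      Q , Q-Δ , Q⊆s , ∁Q⊆t∪u = Δ⁰₁-between em s t∪u cover

      P⊆Q : P ⊆ section Q f
      P⊆Q {g} g∈P = case em {Q (f , g)} of λ where
        (yes fg∈Q) → fg∈Q
        -- Outside `Q` the point lies in `B`, contradicting `g∈P`, or in the cylinder over the
        -- complement of the singleton, which `f` itself avoids.
        (no  fg∉Q) → ⊥-elim ([ (λ fg∈t → B⊆∁P (t⊆B fg∈t) g∈P)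
                             , (λ fg∈u → u⊆f≢ fg∈u λ _ → refl) ]′ (⊆t∪u (∁Q⊆t∪u fg∉Q)))
  in Q , Q-Δ , P⊆Q , λ fg∈Q → A⊆P (s⊆A (Q⊆s fg∈Q))
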